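{- Let $q$ be a prime power and let $\Gamma$ be the set of roots in $\mathbb{F}_{q^3}$ of $X^{q^2}+X^q+X$. Then the polynomial $(X^q-X)\circ X^3=X^{3q}-X^3$ permutes $\Gamma$ (i.e. maps $\Gamma$ bijectively onto $\Gamma$) if and only if $q\equiv 2\pmod 3$. -}

module Defs where

open import Algebra.Apartness.Bundles using (HeytingCommutativeRing; HeytingField)
open import Algebra.Bundles using (CommutativeRing)
import Algebra.Properties.Semiring.Exp as SemiringExp
open import Data.Fin.Base using (Fin)
open import Data.Nat.Base as ℕ using (ℕ; suc)
open import Data.Nat.Primality using (Prime)
open import Data.Product.Base using (Σ-syntax; ∃; ∃₂; _×_; _,_)
open import Function.Base using (_∘_)
open import Function.Bundles using (Inverse)
open import Function.Definitions using (Bijective)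
open import Level using (_⊔_)
open import Relation.Binary.Core using (Rel)
open import Relation.Binary.PropositionalEquality using (_≡_; setoid)
open import Relation.Unary using (Pred)

IsPrimePower : ℕ → Set
IsPrimePower q = ∃₂ λ p k → Prime p × q ≡ p ℕ.^ suc k

-- Fields are the library's Heyting fields: x # y holds iff x - y is invertible,
-- and # is irreflexive and tight.  When the carrier is finite, as here, ≈ is
-- decidable and # coincides with ≉, so these are exactly the usual finite fields.
module FieldDefs {c ℓ₁ ℓ₂} (F : HeytingField c ℓ₁ ℓ₂) where

  open HeytingField F public using (Carrier; _≈_; _+_; _-_; 0#)

  commutativeRing : CommutativeRing c ℓ₁
  commutativeRing =
    HeytingCommutativeRing.commutativeRing (HeytingField.heytingCommutativeRing F)

  open SemiringExp (CommutativeRing.semiring commutativeRing) public using (_^_)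

  HasOrder : ℕ → Set (c ⊔ ℓ₁)
  HasOrder n = Inverse (CommutativeRing.setoid commutativeRing) (setoid (Fin n))

  restrict : ∀ {ℓ} (P : Pred Carrier ℓ) (f : Carrier → Carrier) →
             (∀ {x} → P x → P (f x)) → ∃ P → ∃ P
  restrict P f maps (x , Px) = f x , maps Px

  -- Equality on the subset ignores the membership proofs.
  Permutes : ∀ {ℓ} → (Carrier → Carrier) → Pred Carrier ℓ → Set (c ⊔ ℓ₁ ⊔ ℓ)
  Permutes f P = Σ[ maps ∈ (∀ {x} → P x → P (f x)) ]
    Bijective _≈P_ _≈P_ (restrict P f maps)
    where
    _≈P_ : Rel (∃ P) ℓ₁
    (x , _) ≈P (y , _) = x ≈ y

  Γ : ℕ → Pred Carrier ℓ₁
  Γ q x = x ^ (q ℕ.^ 2) + x ^ q + x ≈ 0#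

  -- The function induced by the polynomial (X^q - X) ∘ X^3.
  [X^_-X]∘X^3 : ℕ → Carrier → Carrier
  [X^ q -X]∘X^3 = (λ y → y ^ q - y) ∘ (λ x → x ^ 3)

{-# OPTIONS --safe #-}

-- Write φ x = x^q, so that Γ is the kernel of the trace φ² + φ + 1, and put
-- Q x = x² + x φ x + (φ x)².  Factoring a difference of cubes, f x = Q x (φ x - x),
-- and on Γ the value Q x is fixed by φ while Q (t x) = t² Q x for t fixed by φ.
-- If q ≡ 2 (mod 3), then φ - 1 is bijective on Γ, cubing is bijective on the fixed
-- field, and Q has no nonzero root in Γ.  Hence f x determines Q x · x, then
-- (Q x)³ = Q (Q x · x), then Q x, then x; surjectivity follows by rescaling.
-- If 3 ∣ q, then 0 and 1 lie in Γ with the same image; if q ≡ 1 (mod 3), so do x and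
-- ω x for x ∈ Γ nonzero and ω ≠ 1 a cube root of unity in the fixed field.
module Submission where

open import Defs
open import Algebra.Apartness.Bundles using (HeytingField)
open import Algebra.Bundles using (CommutativeRing)
import Algebra.Properties.CommutativeMonoid.Sum as CommutativeMonoidSum
import Algebra.Properties.CommutativeSemiring.Binomial as BinomialTheorem
import Algebra.Properties.CommutativeSemiring.Exp as Exp
import Algebra.Properties.AbelianGroup as AbelianGroupProperties
import Algebra.Properties.Group as GroupProperties
import Algebra.Properties.Ring as RingProperties
import Algebra.Properties.Semiring.Mult as Mult
import Algebra.Solver.Ring.NaturalCoefficients.Default as SemiringSolver
open import Data.Empty using (⊥-elim)
open import Data.Fin.Base as Fin using (Fin; zero; suc; fromℕ; inject₁; inject≤; punchIn)
open import Data.Fin.Permutation using (Permutation′)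
import Data.Fin.Properties as Fin
open import Data.Nat.Base as ℕ using (ℕ; zero; suc; _%_; _<_; s<s; z<s; s≤s)
open import Data.Nat.Combinatorics using (_C_; nCn≡1; nC1≡n; nCk+nC[k+1]≡[n+1]C[k+1])
open import Data.Nat.Divisibility using (_∣_; divides; >⇒∤; m∣m*n; m%n≡0⇒n∣m)
open import Data.Nat.DivMod using (m≡m%n+[m/n]*n; m%n<n)
open import Data.Nat.Primality using (Prime; prime?; prime⇒irreducible; prime⇒nonTrivial; euclidsLemma)
import Data.Nat.Properties as ℕ
open import Data.Nat.Solver using (module +-*-Solver)
open import Data.Product.Base using (∃-syntax; _×_; _,_; proj₁; proj₂)
open import Data.Sum.Base using (inj₁; inj₂)
open import Data.Vec.Base as Vec using (Vec; []; _∷_)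
open import Data.Vec.Functional using (removeAt)
open import Function.Base using (_∘_; _$_)
open import Function.Bundles using (_⇔_; mk⇔; Inverse)
import Function.Construct.Composition as Composition
import Function.Construct.Symmetry as Symmetry
open import Function.Definitions using (Injective)
import Relation.Binary.Reasoning.Setoid as SetoidReasoning
open import Relation.Binary.Definitions using (Decidable)
open import Relation.Binary.PropositionalEquality as ≡ using (_≡_; _≢_)
open import Relation.Nullary using (¬_; yes; no; contradiction)
open import Relation.Nullary.Decidable using (map′; toWitness; decidable-stable; ¬?)

-- Divisibility of binomial coefficients and of powers.

-- This moves the factor `suc n` outside the coefficient, so that Euclid's lemma applies when
-- `suc n` is prime.
absorption : ∀ n k → suc k ℕ.* (suc n C suc k) ≡ suc n ℕ.* (n C k)
absorption zero    zero    = ≡.refl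
absorption zero    (suc k) = ℕ.*-zeroʳ (suc (suc k))
absorption (suc n) zero    = begin
  1 ℕ.* (suc (suc n) C 1)      ≡⟨ ℕ.*-identityˡ _ ⟩
  suc (suc n) C 1              ≡⟨ nC1≡n (suc (suc n)) ⟩
  suc (suc n)                  ≡⟨ ℕ.*-identityʳ _ ⟨
  suc (suc n) ℕ.* (suc n C 0)  ∎
  where open ≡.≡-Reasoning
absorption (suc n) (suc k) = begin
  (2 ℕ.+ k) ℕ.* (suc (suc n) C suc (suc k))
    ≡⟨ ≡.cong ((2 ℕ.+ k) ℕ.*_) (nCk+nC[k+1]≡[n+1]C[k+1] (suc n) (suc k)) ⟨
  (2 ℕ.+ k) ℕ.* (A ℕ.+ B)
    ≡⟨ solve 3 (λ k a b → (con 2 :+ k) :* (a :+ b) := a :+ ((con 1 :+ k) :* a :+ (con 2 :+ k) :* b)) ≡.refl k A B ⟩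
  A ℕ.+ (suc k ℕ.* A ℕ.+ (2 ℕ.+ k) ℕ.* B)
    ≡⟨ ≡.cong (A ℕ.+_) (≡.cong₂ ℕ._+_ (absorption n k) (absorption n (suc k))) ⟩
  A ℕ.+ (suc n ℕ.* (n C k) ℕ.+ suc n ℕ.* (n C suc k))
    ≡⟨ ≡.cong (A ℕ.+_) (ℕ.*-distribˡ-+ (suc n) (n C k) (n C suc k)) ⟨
  A ℕ.+ suc n ℕ.* (n C k ℕ.+ n C suc k)
    ≡⟨ ≡.cong (λ z → A ℕ.+ suc n ℕ.* z) (nCk+nC[k+1]≡[n+1]C[k+1] n k) ⟩
  suc (suc n) ℕ.* (suc n C suc k) ∎
  where
  open ≡.≡-Reasoning
  open +-*-Solver
  A = suc n C suc k
  B = suc n C suc (suc k)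

-- By absorption the prime divides `suc k` times the coefficient, and it cannot divide the smaller
-- positive number `suc k`.
prime∣binomial : ∀ {n k} → Prime (suc n) → k < n → suc n ∣ suc n C suc k
prime∣binomial {n} {k} p k<n with euclidsLemma (suc k) _ p (≡.subst (suc n ∣_) (≡.sym (absorption n k)) (m∣m*n (n C k)))
... | inj₁ d = contradiction d (>⇒∤ (s<s k<n))
... | inj₂ d = d

prime∣m^n⇒prime∣m : ∀ {p} → Prime p → ∀ m n → p ∣ m ℕ.^ n → p ∣ m
prime∣m^n⇒prime∣m pr m zero p∣1 = contradiction p∣1 (>⇒∤ (ℕ.nonTrivial⇒n>1 _ {{prime⇒nonTrivial pr}}))
prime∣m^n⇒prime∣m pr m (suc n) d with euclidsLemma m _ pr d
... | inj₁ d = d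
... | inj₂ d = prime∣m^n⇒prime∣m pr m n d

3∣p^k⇒p≡3 : ∀ {p} k → Prime p → 3 ∣ p ℕ.^ k → p ≡ 3
3∣p^k⇒p≡3 {p} k pr d with prime⇒irreducible pr (prime∣m^n⇒prime∣m (toWitness {a? = prime? 3} _) p k d)
... | inj₂ 3≡p = ≡.sym 3≡p

-- For `q = 1 + 3j` this exhibits the integer `(q³ - 1) / 3`, the exponent that later produces a
-- cube root of unity.
[1+3j]³≡1+3m : ∀ j →
  (1 ℕ.+ 3 ℕ.* j) ℕ.^ 3 ≡ 1 ℕ.+ (3 ℕ.* j ℕ.+ 9 ℕ.* (j ℕ.* j) ℕ.+ 9 ℕ.* (j ℕ.* (j ℕ.* j))) ℕ.* 3
[1+3j]³≡1+3m = solve 1 (λ j →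
  (con 1 :+ con 3 :* j) :^ 3 := con 1 :+ (con 3 :* j :+ con 9 :* (j :* j) :+ con 9 :* (j :* (j :* j))) :* con 3) ≡.refl
  where open +-*-Solver

-- Frobenius maps in prime characteristic.

module Characteristic {c ℓ} (R : CommutativeRing c ℓ) where

  open CommutativeRing R renaming (zero to *-zero)
  open Exp commutativeSemiring
  open Mult semiring using (×-cong; ×-assoc-*; ×1-homo-*; ×-homo-1) renaming (_×_ to _×′_)
  open CommutativeMonoidSum +-commutativeMonoid
  open SetoidReasoning setoid

  ×-annihilates : ∀ {p m} → p ×′ 1# ≈ 0# → p ∣ m → ∀ x → m ×′ x ≈ 0#
  ×-annihilates {p} {m} char (divides k m≡k*p) x = begin
    m ×′ x                 ≈⟨ ×-cong m≡k*p (sym (*-identityˡ x)) ⟩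
    (k ℕ.* p) ×′ (1# * x)  ≈⟨ ×-assoc-* (k ℕ.* p) 1# x ⟨
    ((k ℕ.* p) ×′ 1#) * x  ≈⟨ *-congʳ (×1-homo-* k p) ⟩
    (k ×′ 1# * p ×′ 1#) * x ≈⟨ *-congʳ (*-congˡ char) ⟩
    (k ×′ 1# * 0#) * x     ≈⟨ *-congʳ (zeroʳ _) ⟩
    0# * x                 ≈⟨ zeroˡ x ⟩
    0#                     ∎

  -- The binomial terms of index 0 and `p` give the two powers; every other term has a coefficient
  -- divisible by `p` and vanishes.
  ^p-homo-+ : ∀ {p} → Prime p → p ×′ 1# ≈ 0# → ∀ x y → (x + y) ^ p ≈ x ^ p + y ^ p
  ^p-homo-+ {suc n} pr char x y = begin
    (x + y) ^ suc n
      ≈⟨ theorem (suc n) x y ⟩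
    t zero + sum (t ∘ suc)
      ≈⟨ +-congˡ (sum-init-last (t ∘ suc)) ⟩
    t zero + (sum (t ∘ suc ∘ inject₁) + t (suc (fromℕ n)))
      ≈⟨ +-cong t-first (+-cong (trans (sum-cong-≋ t-middle) (sum-replicate-zero n)) t-last) ⟩
    y ^ suc n + (0# + x ^ suc n)
      ≈⟨ trans (+-congˡ (+-identityˡ _)) (+-comm _ _) ⟩
    x ^ suc n + y ^ suc n ∎
    where
    open BinomialTheorem commutativeSemiring
    t : Fin (suc (suc n)) → Carrier
    t = binomialTerm x y (suc n)
    t-first : t zero ≈ y ^ suc n
    t-first = trans (×-homo-1 _) (*-identityˡ _)
    t-middle : ∀ j → t (suc (inject₁ j)) ≈ 0#
    t-middle j = ×-annihilates char
      (prime∣binomial pr (≡.subst (_< n) (≡.sym (Fin.toℕ-inject₁ j)) (Fin.toℕ<n j))) _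
    t-last : t (suc (fromℕ n)) ≈ x ^ suc n
    t-last rewrite Fin.toℕ-fromℕ n | nCn≡1 (suc n) | ℕ.n∸n≡0 n =
      trans (×-homo-1 _) (*-identityʳ _)

  ^p^k-homo-+ : ∀ {p} → Prime p → p ×′ 1# ≈ 0# → ∀ k x y →
                (x + y) ^ (p ℕ.^ k) ≈ x ^ (p ℕ.^ k) + y ^ (p ℕ.^ k)
  ^p^k-homo-+ pr char zero x y =
    trans (*-identityʳ _) (sym (+-cong (*-identityʳ x) (*-identityʳ y)))
  ^p^k-homo-+ {p} pr char (suc k) x y = begin
    (x + y) ^ (p ℕ.* r)    ≈⟨ ^-assocʳ (x + y) p r ⟨
    ((x + y) ^ p) ^ r      ≈⟨ ^-congˡ r (^p-homo-+ pr char x y) ⟩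
    (x ^ p + y ^ p) ^ r    ≈⟨ ^p^k-homo-+ pr char k (x ^ p) (y ^ p) ⟩
    (x ^ p) ^ r + (y ^ p) ^ r ≈⟨ +-cong (^-assocʳ x p r) (^-assocʳ y p r) ⟩
    x ^ (p ℕ.* r) + y ^ (p ℕ.* r) ∎
    where r = p ℕ.^ k

-- Arithmetic in a finite field.

module FiniteField {c ℓ₁ ℓ₂} (F : HeytingField c ℓ₁ ℓ₂) {N} (order : FieldDefs.HasOrder F N) where

  open HeytingField F using (_#_; #-irrefl; #⇒invertible; invertible⇒#; tight)
  open FieldDefs F using (commutativeRing)
  open CommutativeRing commutativeRing hiding (zero)
  open Exp commutativeSemiring
  open Mult semiring using () renaming (_×_ to _×′_)
  open GroupProperties +-group using (x∙y⁻¹≈ε⇒x≈y; x≈y⇒x∙y⁻¹≈ε; identityʳ-unique; ε⁻¹≈ε)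
  open RingProperties ring using (x[y-z]≈xy-xz; [y-z]x≈yx-zx)
  open SemiringSolver commutativeSemiring using (solve; _:+_; _:*_; _:=_; con)
  open SetoidReasoning setoid
  open Inverse order using (to; from; to-cong; strictlyInverseˡ; strictlyInverseʳ)
  module Σ = CommutativeMonoidSum +-commutativeMonoid
  module Π = CommutativeMonoidSum *-commutativeMonoid

  infix 4 _≟_
  _≟_ : Decidable _≈_
  x ≟ y = map′ (λ e → trans (sym (strictlyInverseʳ x)) (trans (reflexive (≡.cong from e)) (strictlyInverseʳ y)))
               to-cong (to x Fin.≟ to y)

  from-injective : Injective _≡_ _≈_ from
  from-injective {i} {j} e =
    ≡.trans (≡.sym (strictlyInverseˡ i)) (≡.trans (to-cong e) (strictlyInverseˡ j))

  -- Inverses are given for elements apart from zero, so the finite carrier is searched; were the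
  -- search to fail, `x` would not be apart from zero and tightness would give `x ≈ 0#`.
  inverse : ∀ {x} → x ≉ 0# → ∃[ y ] y * x ≈ 1#
  inverse {x} x≉0 with Fin.any? (λ i → from i * x ≟ 1#)
  ... | yes (i , e) = from i , e
  ... | no none = contradiction (tight x 0# .proj₁ ¬x#0) x≉0
    where
    x-0≈x : x - 0# ≈ x
    x-0≈x = trans (+-congˡ ε⁻¹≈ε) (+-identityʳ x)
    ¬x#0 : ¬ (x # 0#)
    ¬x#0 x#0 with #⇒invertible x#0
    ... | y , yx≈1 , _ = none (to y , trans (*-cong (strictlyInverseʳ y) (sym x-0≈x)) yx≈1)

  -- If `1# ≈ 0#` then all elements coincide, so `0# - 0#` is invertible and `0#` is apart from
  -- itself.
  1≉0 : 1# ≉ 0#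
  1≉0 1≈0 = #-irrefl refl (invertible⇒# {0#} {0#} (0# , collapse _ _ , collapse _ _))
    where
    collapse : ∀ x y → x ≈ y
    collapse x y = trans (to0 x) (sym (to0 y))
      where
      to0 : ∀ z → z ≈ 0#
      to0 z = trans (sym (*-identityˡ z)) (trans (*-congʳ 1≈0) (zeroˡ z))

  x*y≈0⇒y≈0 : ∀ {x y} → x ≉ 0# → x * y ≈ 0# → y ≈ 0#
  x*y≈0⇒y≈0 {x} {y} x≉0 xy≈0 with inverse x≉0
  ... | x⁻¹ , x⁻¹x≈1 = begin
    y              ≈⟨ *-identityˡ y ⟨
    1# * y         ≈⟨ *-congʳ x⁻¹x≈1 ⟨
    (x⁻¹ * x) * y  ≈⟨ *-assoc _ _ _ ⟩
    x⁻¹ * (x * y)  ≈⟨ *-congˡ xy≈0 ⟩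
    x⁻¹ * 0#       ≈⟨ zeroʳ _ ⟩
    0#             ∎

  x≈y⇒x-y≈0 : ∀ {x y} → x ≈ y → x - y ≈ 0#
  x≈y⇒x-y≈0 = x≈y⇒x∙y⁻¹≈ε

  x-y≈0⇒x≈y : ∀ {x y} → x - y ≈ 0# → x ≈ y
  x-y≈0⇒x≈y = x∙y⁻¹≈ε⇒x≈y _ _

  *-cancelˡ : ∀ {x y z} → x ≉ 0# → x * y ≈ x * z → y ≈ z
  *-cancelˡ x≉0 e = x-y≈0⇒x≈y (x*y≈0⇒y≈0 x≉0 (trans (x[y-z]≈xy-xz _ _ _) (x≈y⇒x-y≈0 e)))

  x*z≈y*z⇒z≈0 : ∀ {x y z} → x ≉ y → x * z ≈ y * z → z ≈ 0#
  x*z≈y*z⇒z≈0 x≉y e = x*y≈0⇒y≈0 (x≉y ∘ x-y≈0⇒x≈y) (trans ([y-z]x≈yx-zx _ _ _) (x≈y⇒x-y≈0 e))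

  x^n≈0⇒x≈0 : ∀ {x} n → x ^ n ≈ 0# → x ≈ 0#
  x^n≈0⇒x≈0 zero 1≈0 = contradiction 1≈0 1≉0
  x^n≈0⇒x≈0 {x} (suc n) e with x ≟ 0#
  ... | yes x≈0 = x≈0
  ... | no x≉0 = x^n≈0⇒x≈0 n (x*y≈0⇒y≈0 x≉0 e)

  -- Conjugation by the enumeration makes a bijection of the field a permutation of indices, so sums
  -- and products over the field can be reindexed.
  rearrangement : Inverse setoid setoid → Permutation′ N
  rearrangement σ = Composition.inverse (Symmetry.inverse order) (Composition.inverse σ order)

  translation : Carrier → Inverse setoid setoid
  translation a = record
    { to = _+ a ; from = _- a ; to-cong = +-congʳ ; from-cong = +-congʳ
    ; inverse = (λ e → trans (+-congʳ e) (trans (+-assoc _ _ _) (trans (+-congˡ (-‿inverseˡ a)) (+-identityʳ _))))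
              , (λ e → trans (+-congʳ e) (trans (+-assoc _ _ _) (trans (+-congˡ (-‿inverseʳ a)) (+-identityʳ _))))
    }

  dilation : ∀ {a} → a ≉ 0# → Inverse setoid setoid
  dilation {a} a≉0 with inverse a≉0
  ... | a⁻¹ , a⁻¹a≈1 = record
    { to = a *_ ; from = a⁻¹ *_ ; to-cong = *-congˡ ; from-cong = *-congˡ
    ; inverse = (λ e → trans (*-congˡ e) (undo (trans (*-comm _ _) a⁻¹a≈1)))
              , (λ e → trans (*-congˡ e) (undo a⁻¹a≈1))
    }
    where
    undo : ∀ {b b′ x} → b′ * b ≈ 1# → b′ * (b * x) ≈ x
    undo e = trans (sym (*-assoc _ _ _)) (trans (*-congʳ e) (*-identityˡ _))

  -- Translation by `1#` permutes the field, so adding `N ×′ 1#` does not change the sum of all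
  -- elements.
  order×1≈0 : N ×′ 1# ≈ 0#
  order×1≈0 = identityʳ-unique (Σ.sum from) (N ×′ 1#) $ begin
    Σ.sum from + N ×′ 1#             ≈⟨ +-congˡ (Σ.sum-replicate N) ⟨
    Σ.sum from + Σ.sum {N} (λ _ → 1#) ≈⟨ Σ.∑-distrib-+ from (λ _ → 1#) ⟨
    Σ.sum (λ i → from i + 1#)        ≈⟨ Σ.sum-cong-≋ (λ i → strictlyInverseʳ (from i + 1#)) ⟨
    Σ.sum (λ i → from (to (from i + 1#))) ≈⟨ Σ.sum-permute from (rearrangement (translation 1#)) ⟨
    Σ.sum from ∎

  -- The extra factor `a` makes up for the single entry equal to `1#`, so the exponent is `n` rather
  -- than its predecessor.
  product-constant-off : ∀ {n} (t : Fin n → Carrier) {a} k → t k ≈ 1# →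
                         (∀ j → j ≢ k → t j ≈ a) → a * Π.sum t ≈ a ^ n
  product-constant-off {suc n} t {a} k tk≈1 t≈a = *-congˡ $ begin
    Π.sum t                    ≈⟨ Π.sum-remove {i = k} t ⟩
    t k * Π.sum (removeAt t k) ≈⟨ *-cong tk≈1 (Π.sum-cong-≋ (λ j → t≈a (punchIn k j) (Fin.punchInᵢ≢i k j))) ⟩
    1# * Π.sum {n} (λ _ → a)   ≈⟨ *-identityˡ _ ⟩
    Π.sum {n} (λ _ → a)        ≈⟨ Π.sum-replicate n ⟩
    a ^ n                      ∎

  Π≉0 : ∀ {n} (t : Fin n → Carrier) → (∀ i → t i ≉ 0#) → Π.sum t ≉ 0#
  Π≉0 {zero}  t t≉0 = 1≉0
  Π≉0 {suc n} t t≉0 = Π≉0 (t ∘ suc) (t≉0 ∘ suc) ∘ x*y≈0⇒y≈0 (t≉0 zero)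

  -- Multiplication by a ≉ 0 permutes F, so it preserves the product of the nonzero elements.
  x^order≈x : ∀ x → x ^ N ≈ x
  x^order≈x a with a ≟ 0#
  ... | yes a≈0 = trans (0^n≈0 (to 0#)) (sym a≈0)
    where
    0^n≈0 : ∀ {n} → Fin n → a ^ n ≈ 0#
    0^n≈0 {suc n} _ = trans (*-congʳ a≈0) (zeroˡ _)
  ... | no a≉0 = begin
    a ^ N                              ≈⟨ product-constant-off (scale ∘ from) (to 0#) scale-0 scale-a ⟨
    a * Π.sum (scale ∘ from)           ≈⟨ *-congˡ Πscale≈1 ⟩
    a * 1#                             ≈⟨ *-identityʳ a ⟩
    a                                  ∎
    where
    -- Both functions take the default `1#` at zero: `nonzeroPart` then has a nonzero product over
    -- the whole field, and `scale` is the factor by which it changes under multiplication by `a`,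
    -- also at zero.
    nonzeroPart scale : Carrier → Carrier
    nonzeroPart x with x ≟ 0#
    ... | yes _ = 1#
    ... | no _  = x
    scale x with x ≟ 0#
    ... | yes _ = 1#
    ... | no _  = a

    nonzeroPart≉0 : ∀ x → nonzeroPart x ≉ 0#
    nonzeroPart≉0 x with x ≟ 0#
    ... | yes _  = 1≉0
    ... | no x≉0 = x≉0

    scale-0 : scale (from (to 0#)) ≈ 1#
    scale-0 with from (to 0#) ≟ 0#
    ... | yes _ = refl
    ... | no ≉0 = contradiction (strictlyInverseʳ 0#) ≉0

    scale-a : ∀ j → j ≢ to 0# → scale (from j) ≈ a
    scale-a j j≢ with from j ≟ 0#
    ... | yes e = contradiction (≡.trans (≡.sym (strictlyInverseˡ j)) (to-cong e)) j≢
    ... | no _  = refl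

    nonzeroPart-* : ∀ x y → y ≈ a * x → nonzeroPart y ≈ scale x * nonzeroPart x
    nonzeroPart-* x y e with x ≟ 0# | y ≟ 0#
    ... | yes _  | yes _  = sym (*-identityˡ 1#)
    ... | yes x≈0 | no y≉0 = contradiction (trans e (trans (*-congˡ x≈0) (zeroʳ a))) y≉0
    ... | no x≉0 | yes y≈0 = contradiction (x*y≈0⇒y≈0 a≉0 (trans (sym e) y≈0)) x≉0
    ... | no _   | no _   = e

    P : Carrier
    P = Π.sum (nonzeroPart ∘ from)

    Πscale≈1 : Π.sum (scale ∘ from) ≈ 1#
    Πscale≈1 = *-cancelˡ (Π≉0 (nonzeroPart ∘ from) (nonzeroPart≉0 ∘ from)) $ begin
      P * Π.sum (scale ∘ from)  ≈⟨ *-comm _ _ ⟩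
      Π.sum (scale ∘ from) * P  ≈⟨ Π.∑-distrib-+ (scale ∘ from) (nonzeroPart ∘ from) ⟨
      Π.sum (λ i → scale (from i) * nonzeroPart (from i))
        ≈⟨ Π.sum-cong-≋ (λ i → nonzeroPart-* (from i) (from (to (a * from i))) (strictlyInverseʳ _)) ⟨
      Π.sum (λ i → nonzeroPart (from (to (a * from i))))
        ≈⟨ Π.sum-permute (nonzeroPart ∘ from) (rearrangement (dilation a≉0)) ⟨
      P                         ≈⟨ *-identityʳ P ⟨
      P * 1#                    ∎

  -- Counting roots of polynomials.

  -- Monic polynomials of degree n in Horner form, the leading coefficient left implicit.
  ⟦_⟧ : ∀ {n} → Vec Carrier n → Carrier → Carrier
  ⟦ [] ⟧     x = 1#
  ⟦ a ∷ as ⟧ x = a + x * ⟦ as ⟧ x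

  -- Synthetic division by `X - r`: the coefficients of the quotient are the values at `r` of the
  -- successive Horner tails.
  quotient : ∀ {n} → Vec Carrier (suc n) → Carrier → Vec Carrier n
  quotient (a ∷ [])           r = []
  quotient (a ∷ as@(_ ∷ _)) r = ⟦ as ⟧ r ∷ quotient as r

  -- p(x) - p(r) = (x - r) q(x), moved so that no subtraction occurs.
  quotient-correct : ∀ {n} (as : Vec Carrier (suc n)) r x →
    ⟦ as ⟧ x + r * ⟦ quotient as r ⟧ x ≈ x * ⟦ quotient as r ⟧ x + ⟦ as ⟧ r
  quotient-correct (a ∷ []) r x =
    solve 3 (λ a r x → (a :+ x :* con 1) :+ r :* con 1 := x :* con 1 :+ (a :+ r :* con 1)) refl a r x
  quotient-correct (a ∷ as@(_ ∷ _)) r x = begin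
    (a + x * px) + r * (pr + x * s)
      ≈⟨ solve 6 (λ a r x px pr s → (a :+ x :* px) :+ r :* (pr :+ x :* s)
                                 := x :* (px :+ r :* s) :+ (a :+ r :* pr)) refl a r x px pr s ⟩
    x * (px + r * s) + (a + r * pr)
      ≈⟨ +-congʳ (*-congˡ (quotient-correct as r x)) ⟩
    x * (x * s + pr) + (a + r * pr)
      ≈⟨ +-congʳ (*-congˡ (+-comm _ _)) ⟩
    x * (pr + x * s) + (a + r * pr) ∎
    where
    px = ⟦ as ⟧ x
    pr = ⟦ as ⟧ r
    s = ⟦ quotient as r ⟧ x

  -- Dividing by the root `ρ zero` lowers the degree, and the other values of `ρ` stay roots of the
  -- quotient because they differ from it.
  ¬degree<roots : ∀ {n} (as : Vec Carrier n) (ρ : Fin (suc n) → Carrier) →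
                  Injective _≡_ _≈_ ρ → ¬ (∀ i → ⟦ as ⟧ (ρ i) ≈ 0#)
  ¬degree<roots []           ρ inj root = 1≉0 (root zero)
  ¬degree<roots as@(_ ∷ _) ρ inj root = ¬degree<roots (quotient as r) (ρ ∘ suc) (Fin.suc-injective ∘ inj) λ i →
    let x = ρ (suc i); s = ⟦ quotient as r ⟧ x in
    x*z≈y*z⇒z≈0 (λ e → Fin.0≢1+n (≡.sym (inj e))) $ begin
      x * s              ≈⟨ +-identityʳ _ ⟨
      x * s + 0#         ≈⟨ +-congˡ (root zero) ⟨
      x * s + ⟦ as ⟧ r   ≈⟨ quotient-correct as r x ⟨
      ⟦ as ⟧ x + r * s   ≈⟨ +-congʳ (root (suc i)) ⟩
      0# + r * s         ≈⟨ +-identityˡ _ ⟩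
      r * s              ∎
    where r = ρ zero

  -- Otherwise every element is a root of the monic polynomial `X^d - X`, and the field supplies
  -- `d + 1` distinct ones.
  ∃x^d≉x : ∀ {d} → 1 < d → d < N → ∃[ x ] x ^ d ≉ x
  ∃x^d≉x {1} (s<s ())
  ∃x^d≉x {suc (suc e)} _ d<N with Fin.any? (λ i → ¬? (from i ^ suc (suc e) ≟ from i))
  ... | yes (i , ne) = from i , ne
  -- The vector lists the coefficients of `X^d - X` below the leading one, constant term first, with
  -- `d = e + 2`.
  ... | no none = ⊥-elim $ ¬degree<roots (0# ∷ - 1# ∷ Vec.replicate e 0#) (λ i → from (inject≤ i d<N))
    (Fin.inject≤-injective d<N d<N _ _ ∘ from-injective)
    λ i → let x = from (inject≤ i d<N) in begin
      0# + x * (- 1# + x * ⟦ Vec.replicate e 0# ⟧ x)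
        ≈⟨ trans (+-identityˡ _) (*-congˡ (+-congˡ (*-congˡ (power e x)))) ⟩
      x * (- 1# + x * x ^ e)
        ≈⟨ trans (*-congˡ (+-comm _ _)) (x[y-z]≈xy-xz x (x * x ^ e) 1#) ⟩
      x ^ suc (suc e) - x * 1#
        ≈⟨ x≈y⇒x-y≈0 (trans (decidable-stable (_ ≟ _) (λ ne → none (inject≤ i d<N , ne))) (sym (*-identityʳ x))) ⟩
      0# ∎
    where
    power : ∀ e x → ⟦ Vec.replicate e 0# ⟧ x ≈ x ^ e
    power zero    x = refl
    power (suc e) x = trans (+-identityˡ _) (*-congˡ (power e x))

-- The Frobenius map `φ` and the trace.

module Trace {ℓ₀ ℓ₁ ℓ₂} (F : HeytingField ℓ₀ ℓ₁ ℓ₂) (p k : ℕ) (p-prime : Prime p)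
             (order : FieldDefs.HasOrder F ((p ℕ.^ suc k) ℕ.^ 3)) where

  open FieldDefs F using (commutativeRing; Γ; [X^_-X]∘X^3; Permutes)
  open CommutativeRing commutativeRing hiding (zero)
  open Exp commutativeSemiring
  open Mult semiring using (×-congˡ; ×1-homo-*; ×-homo-+; ×-homo-1) renaming (_×_ to _×′_)
  open GroupProperties +-group using (inverseˡ-unique; ∙-cancelʳ)
  open AbelianGroupProperties +-abelianGroup using (⁻¹-∙-comm; ⁻¹-anti-homo‿-)
  open RingProperties ring using (x[y-z]≈xy-xz)
  open SemiringSolver commutativeSemiring using (solve; _:+_; _:*_; _:=_; con)
  open SetoidReasoning setoid
  open FiniteField F order
  open Characteristic commutativeRing

  q : ℕ
  q = p ℕ.^ suc k

  1<q : 1 < q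
  1<q = ℕ.^-monoʳ-< p (ℕ.nonTrivial⇒n>1 p {{prime⇒nonTrivial p-prime}}) {0} {suc k} z<s

  q<q³ : q < q ℕ.^ 3
  q<q³ = ≡.subst (_< q ℕ.^ 3) (ℕ.^-identityʳ q) (ℕ.^-monoʳ-< q 1<q {1} {3} (s<s z<s))

  ×1-homo-^ : ∀ m n → (m ℕ.^ n) ×′ 1# ≈ (m ×′ 1#) ^ n
  ×1-homo-^ m zero    = ×-homo-1 1#
  ×1-homo-^ m (suc n) = trans (×1-homo-* m (m ℕ.^ n)) (*-congˡ (×1-homo-^ m n))

  -- The order of the field is `q³`, so the cube of `q ×′ 1#` is zero, and a field has no nonzero
  -- nilpotents.
  q×1≈0 : q ×′ 1# ≈ 0#
  q×1≈0 = x^n≈0⇒x≈0 3 (trans (sym (×1-homo-^ q 3)) order×1≈0)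

  p×1≈0 : p ×′ 1# ≈ 0#
  p×1≈0 = x^n≈0⇒x≈0 (suc k) (trans (sym (×1-homo-^ p (suc k))) q×1≈0)

  φ : Carrier → Carrier
  φ x = x ^ q

  φ-cong : ∀ {x y} → x ≈ y → φ x ≈ φ y
  φ-cong = ^-congˡ q

  φ-homo-* : ∀ x y → φ (x * y) ≈ φ x * φ y
  φ-homo-* x y = ^-distrib-* x y q

  φ-homo-+ : ∀ x y → φ (x + y) ≈ φ x + φ y
  φ-homo-+ = ^p^k-homo-+ p-prime p×1≈0 (suc k)

  φ-0 : φ 0# ≈ 0#
  φ-0 = ∙-cancelʳ (φ 0#) (φ 0#) 0# $ begin
    φ 0# + φ 0#  ≈⟨ φ-homo-+ 0# 0# ⟨
    φ (0# + 0#)  ≈⟨ φ-cong (+-identityˡ 0#) ⟩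
    φ 0#         ≈⟨ +-identityˡ _ ⟨
    0# + φ 0#    ∎

  1^n≈1 : ∀ n → 1# ^ n ≈ 1#
  1^n≈1 zero    = refl
  1^n≈1 (suc n) = trans (*-identityˡ _) (1^n≈1 n)

  φ-1 : φ 1# ≈ 1#
  φ-1 = 1^n≈1 q

  φ-homo-neg : ∀ x → φ (- x) ≈ - φ x
  φ-homo-neg x = inverseˡ-unique _ _ $ begin
    φ (- x) + φ x  ≈⟨ φ-homo-+ (- x) x ⟨
    φ (- x + x)    ≈⟨ φ-cong (-‿inverseˡ x) ⟩
    φ 0#           ≈⟨ φ-0 ⟩
    0#             ∎

  φ-homo-sub : ∀ x y → φ (x - y) ≈ φ x - φ y
  φ-homo-sub x y = trans (φ-homo-+ x (- y)) (+-congˡ (φ-homo-neg y))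

  φ-homo-^ : ∀ x n → φ (x ^ n) ≈ φ x ^ n
  φ-homo-^ x zero    = φ-1
  φ-homo-^ x (suc n) = trans (φ-homo-* x (x ^ n)) (*-congˡ (φ-homo-^ x n))

  x^q²≈φφx : ∀ x → x ^ (q ℕ.^ 2) ≈ φ (φ x)
  x^q²≈φφx x = trans (^-congʳ x (≡.cong (q ℕ.*_) (ℕ.*-identityʳ q))) (sym (^-assocʳ x q q))

  φ³≈id : ∀ x → φ (φ (φ x)) ≈ x
  φ³≈id x = begin
    φ (φ (φ x))         ≈⟨ x^q²≈φφx (φ x) ⟨
    (x ^ q) ^ (q ℕ.^ 2) ≈⟨ ^-assocʳ x q (q ℕ.^ 2) ⟩
    x ^ (q ℕ.^ 3)       ≈⟨ x^order≈x x ⟩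
    x                   ∎

  tr : Carrier → Carrier
  tr x = φ (φ x) + φ x + x

  Γ⇒tr≈0 : ∀ {x} → Γ q x → tr x ≈ 0#
  Γ⇒tr≈0 {x} = trans (sym (+-congʳ (+-congʳ (x^q²≈φφx x))))

  tr≈0⇒Γ : ∀ {x} → tr x ≈ 0# → Γ q x
  tr≈0⇒Γ {x} = trans (+-congʳ (+-congʳ (x^q²≈φφx x)))

  φ-fixed-* : ∀ {t} x → φ t ≈ t → φ (t * x) ≈ t * φ x
  φ-fixed-* {t} x φt≈t = trans (φ-homo-* t x) (*-congʳ φt≈t)

  tr-fixed-* : ∀ {t} x → φ t ≈ t → tr (t * x) ≈ t * tr x
  tr-fixed-* {t} x φt≈t = begin
    φ (φ (t * x)) + φ (t * x) + t * x
      ≈⟨ +-congʳ (+-cong (trans (φ-cong (φ-fixed-* x φt≈t)) (φ-fixed-* (φ x) φt≈t)) (φ-fixed-* x φt≈t)) ⟩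
    t * φ (φ x) + t * φ x + t * x
      ≈⟨ solve 4 (λ t a b c → t :* c :+ t :* b :+ t :* a := t :* (c :+ b :+ a)) refl t x (φ x) (φ (φ x)) ⟩
    t * tr x ∎

  tr≈0-fixed-* : ∀ {t x} → φ t ≈ t → tr x ≈ 0# → tr (t * x) ≈ 0#
  tr≈0-fixed-* {t} {x} φt≈t tr≈0 = trans (tr-fixed-* x φt≈t) (trans (*-congˡ tr≈0) (zeroʳ t))

  tr-homo-sub : ∀ x y → tr (x - y) ≈ tr x - tr y
  tr-homo-sub x y = begin
    φ (φ (x - y)) + φ (x - y) + (x - y)
      ≈⟨ +-congʳ (+-cong (trans (φ-cong (φ-homo-sub x y)) (φ-homo-sub (φ x) (φ y))) (φ-homo-sub x y)) ⟩
    (φ (φ x) - φ (φ y)) + (φ x - φ y) + (x - y)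
      ≈⟨ solve 6 (λ a b c a′ b′ c′ → (c :+ c′) :+ (b :+ b′) :+ (a :+ a′)
                                  := (c :+ b :+ a) :+ (c′ :+ b′ :+ a′)) refl x (φ x) (φ (φ x)) (- y) (- φ y) (- φ (φ y)) ⟩
    tr x + (- φ (φ y) + - φ y + - y)
      ≈⟨ +-congˡ (trans (+-congʳ (⁻¹-∙-comm _ _)) (⁻¹-∙-comm _ _)) ⟩
    tr x - tr y ∎

  tr-φ : ∀ x → tr (φ x) ≈ tr x
  tr-φ x = begin
    φ (φ (φ x)) + φ (φ x) + φ x ≈⟨ +-congʳ (+-congʳ (φ³≈id x)) ⟩
    x + φ (φ x) + φ x           ≈⟨ solve 3 (λ a b c → a :+ c :+ b := c :+ b :+ a) refl x (φ x) (φ (φ x)) ⟩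
    tr x                        ∎

  tr[φx-x]≈0 : ∀ x → tr (φ x - x) ≈ 0#
  tr[φx-x]≈0 x = trans (tr-homo-sub (φ x) x) (x≈y⇒x-y≈0 (tr-φ x))

  -- The factorisation of `f` and the form `Q`.

  f : Carrier → Carrier
  f = [X^ q -X]∘X^3

  f-cong : ∀ {x y} → x ≈ y → f x ≈ f y
  f-cong e = +-cong (φ-cong (^-congˡ 3 e)) (-‿cong (^-congˡ 3 e))

  Q : Carrier → Carrier
  Q x = x * x + x * φ x + φ x * φ x

  -- Turns a subtraction-free equation, such as the semiring solver can prove, into one between
  -- differences.
  x-y≈z-w : ∀ {x y z w} → x + w ≈ z + y → x - y ≈ z - w
  x-y≈z-w {x} {y} {z} {w} e = begin
    x - y                  ≈⟨ +-identityʳ _ ⟨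
    x - y + 0#             ≈⟨ +-congˡ (-‿inverseʳ w) ⟨
    x - y + (w - w)        ≈⟨ solve 4 (λ x y′ w w′ → x :+ y′ :+ (w :+ w′) := (x :+ w) :+ (y′ :+ w′)) refl x (- y) w (- w) ⟩
    (x + w) + (- y + - w)  ≈⟨ +-congʳ e ⟩
    (z + y) + (- y + - w)  ≈⟨ solve 4 (λ z y y′ w′ → (z :+ y) :+ (y′ :+ w′) := z :+ w′ :+ (y :+ y′)) refl z y (- y) (- w) ⟩
    z - w + (y - y)        ≈⟨ +-congˡ (-‿inverseʳ y) ⟩
    z - w + 0#             ≈⟨ +-identityʳ _ ⟩
    z - w                  ∎

  difference-of-cubes : ∀ x → φ x ^ 3 + Q x * x ≈ Q x * φ x + x ^ 3
  difference-of-cubes x = solve 2 (λ a b →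
    b :* (b :* (b :* con 1)) :+ (a :* a :+ a :* b :+ b :* b) :* a
    := (a :* a :+ a :* b :+ b :* b) :* b :+ a :* (a :* (a :* con 1))) refl x (φ x)

  f≈Q*[φx-x] : ∀ x → f x ≈ Q x * (φ x - x)
  f≈Q*[φx-x] x = begin
    φ (x ^ 3) - x ^ 3     ≈⟨ +-congʳ (φ-homo-^ x 3) ⟩
    φ x ^ 3 - x ^ 3       ≈⟨ x-y≈z-w (difference-of-cubes x) ⟩
    Q x * φ x - Q x * x   ≈⟨ x[y-z]≈xy-xz _ _ _ ⟨
    Q x * (φ x - x)       ∎

  -- With `b = φ a` and `c = φ b`, adding `a * c` makes the two sides `b² + c * tr a` and
  -- `b² + a * tr a`; both are `b²` on the kernel of the trace.
  Q-fixed : ∀ {x} → tr x ≈ 0# → φ (Q x) ≈ Q x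
  Q-fixed {a} tr≈0 = begin
    φ (Q a)
      ≈⟨ trans (φ-homo-+ _ _) (+-cong (trans (φ-homo-+ _ _) (+-cong (φ-homo-* _ _) (φ-homo-* _ _))) (φ-homo-* _ _)) ⟩
    Q b
      ≈⟨ ∙-cancelʳ (a * c) _ _ eq ⟩
    Q a ∎
    where
    b = φ a
    c = φ b
    eq : Q b + a * c ≈ Q a + a * c
    eq = begin
      b * b + b * c + c * c + a * c  ≈⟨ solve 3 (λ a b c → b :* b :+ b :* c :+ c :* c :+ a :* c
                                         := b :* b :+ c :* (c :+ b :+ a)) refl a b c ⟩
      b * b + c * tr a               ≈⟨ +-congˡ (trans (*-congˡ tr≈0) (zeroʳ c)) ⟩
      b * b + 0#                     ≈⟨ +-congˡ (trans (*-congˡ tr≈0) (zeroʳ a)) ⟨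
      b * b + a * tr a               ≈⟨ solve 3 (λ a b c → b :* b :+ a :* (c :+ b :+ a)
                                         := a :* a :+ a :* b :+ b :* b :+ a :* c) refl a b c ⟩
      Q a + a * c                    ∎

  Q-cong : ∀ {x y} → x ≈ y → Q x ≈ Q y
  Q-cong e = +-cong (+-cong (*-cong e e) (*-cong e (φ-cong e))) (*-cong (φ-cong e) (φ-cong e))

  Q-fixed-* : ∀ {t} x → φ t ≈ t → Q (t * x) ≈ t * t * Q x
  Q-fixed-* {t} x φt≈t = begin
    Q (t * x)
      ≈⟨ +-cong (+-congˡ (*-congˡ (φ-fixed-* x φt≈t))) (*-cong (φ-fixed-* x φt≈t) (φ-fixed-* x φt≈t)) ⟩
    t * x * (t * x) + t * x * (t * φ x) + t * φ x * (t * φ x)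
      ≈⟨ solve 3 (λ t x y → t :* x :* (t :* x) :+ t :* x :* (t :* y) :+ t :* y :* (t :* y)
                         := t :* t :* (x :* x :+ x :* y :+ y :* y)) refl t x (φ x) ⟩
    t * t * Q x ∎

  three : Carrier
  three = 3 ×′ 1#

  -- `f x` is `φ y - y` for `y = x ^ 3`, and the trace is invariant under `φ`.
  Γ-f : ∀ x → Γ q (f x)
  Γ-f x = tr≈0⇒Γ (tr[φx-x]≈0 (x ^ 3))

  -- Bijectivity when `q` is 2 modulo 3.

  module q≡2 (j : ℕ) (q≡2+3j : q ≡ 2 ℕ.+ 3 ℕ.* j) where

    -- Since `q = 2 + 3j` vanishes in the field, `3 = 0` would give `2 = 0` and then `1 = 0`.
    3≉0 : three ≉ 0#
    3≉0 3≈0 = 1≉0 $ begin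
      1#                    ≈⟨ +-identityʳ 1# ⟨
      1# + 0#               ≈⟨ +-congˡ 2≈0 ⟨
      three                 ≈⟨ 3≈0 ⟩
      0#                    ∎
      where
      2≈0 : 2 ×′ 1# ≈ 0#
      2≈0 = begin
        2 ×′ 1#                            ≈⟨ +-identityʳ _ ⟨
        2 ×′ 1# + 0#                       ≈⟨ +-congˡ (trans (×1-homo-* 3 j) (trans (*-congʳ 3≈0) (zeroˡ _))) ⟨
        2 ×′ 1# + (3 ℕ.* j) ×′ 1#          ≈⟨ ×-homo-+ 1# 2 (3 ℕ.* j) ⟨
        (2 ℕ.+ 3 ℕ.* j) ×′ 1#              ≈⟨ ×-congˡ q≡2+3j ⟨
        q ×′ 1#                            ≈⟨ q×1≈0 ⟩
        0#                                 ∎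

    -- Isolating the cube expresses `φ x` through `x²` and `x³`, so that equalities between cubes
    -- can be substituted.
    φx≈x²[x³]ʲ : ∀ x → φ x ≈ x * x * (x ^ 3) ^ j
    φx≈x²[x³]ʲ x = begin
      x ^ q                  ≈⟨ ^-congʳ x q≡2+3j ⟩
      x ^ (2 ℕ.+ 3 ℕ.* j)    ≈⟨ ^-homo-* x 2 (3 ℕ.* j) ⟩
      x ^ 2 * x ^ (3 ℕ.* j)  ≈⟨ *-cong (*-congˡ (*-identityʳ x)) (sym (^-assocʳ x 3 j)) ⟩
      x * x * (x ^ 3) ^ j    ∎

    -- The exponent 3(2j + 1) is congruent to 1 modulo q - 1.
    fixed⇒t≈[t³]²ʲ⁺¹ : ∀ {t} → φ t ≈ t → t ≈ t ^ 3 * ((t ^ 3) ^ j * (t ^ 3) ^ j)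
    fixed⇒t≈[t³]²ʲ⁺¹ {t} φt≈t = begin
      t                          ≈⟨ t²T≈t ⟨
      t * t * T                  ≈⟨ *-congʳ (*-congˡ t²T≈t) ⟨
      t * (t * t * T) * T
        ≈⟨ solve 2 (λ t T → t :* (t :* t :* T) :* T := t :* (t :* (t :* con 1)) :* (T :* T)) refl t T ⟩
      t ^ 3 * (T * T)            ∎
      where
      T = (t ^ 3) ^ j
      t²T≈t : t * t * T ≈ t
      t²T≈t = trans (sym (φx≈x²[x³]ʲ t)) φt≈t

    cubing-injective-on-fixed : ∀ {s t} → φ s ≈ s → φ t ≈ t → s ^ 3 ≈ t ^ 3 → s ≈ t
    cubing-injective-on-fixed {s} {t} φs≈s φt≈t e = begin
      s                                    ≈⟨ fixed⇒t≈[t³]²ʲ⁺¹ φs≈s ⟩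
      s ^ 3 * ((s ^ 3) ^ j * (s ^ 3) ^ j)  ≈⟨ *-cong e (*-cong (^-congˡ j e) (^-congˡ j e)) ⟩
      t ^ 3 * ((t ^ 3) ^ j * (t ^ 3) ^ j)  ≈⟨ fixed⇒t≈[t³]²ʲ⁺¹ φt≈t ⟨
      t                                    ∎

    -- On the fixed field the trace is multiplication by 3.
    fixed∧Γ⇒≈0 : ∀ {x} → φ x ≈ x → tr x ≈ 0# → x ≈ 0#
    fixed∧Γ⇒≈0 {x} φx≈x tr≈0 = x*y≈0⇒y≈0 3≉0 $ begin
      three * x        ≈⟨ solve 1 (λ x → (con 1 :+ (con 1 :+ (con 1 :+ con 0))) :* x := x :+ x :+ x) refl x ⟩
      x + x + x        ≈⟨ +-congʳ (+-cong (trans (φ-cong φx≈x) φx≈x) φx≈x) ⟨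
      tr x             ≈⟨ tr≈0 ⟩
      0#               ∎

    -- Q x ≈ 0 means φ x ^ 3 ≈ x ^ 3, which forces φ (φ x) ≈ x, hence φ x ≈ x.
    Q-anisotropic : ∀ {x} → tr x ≈ 0# → Q x ≈ 0# → x ≈ 0#
    Q-anisotropic {a} tr≈0 Qa≈0 with a ≟ 0#
    ... | yes a≈0 = a≈0
    ... | no a≉0 = fixed∧Γ⇒≈0 b≈a tr≈0
      where
      b = φ a
      c = φ b
      b³≈a³ : b ^ 3 ≈ a ^ 3
      b³≈a³ = begin
        b ^ 3               ≈⟨ +-identityʳ _ ⟨
        b ^ 3 + 0#          ≈⟨ +-congˡ (trans (*-congʳ Qa≈0) (zeroˡ a)) ⟨
        b ^ 3 + Q a * a     ≈⟨ difference-of-cubes a ⟩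
        Q a * b + a ^ 3     ≈⟨ +-congʳ (trans (*-congʳ Qa≈0) (zeroˡ b)) ⟩
        0# + a ^ 3          ≈⟨ +-identityˡ _ ⟩
        a ^ 3               ∎
      A = (a ^ 3) ^ j
      c≈a : c ≈ a
      -- As `a` and `b` have equal cubes, `φ a` and `φ b` share the factor `A`:
      -- `a² c = b² (a² A) = b² b = a³`, and `a²` cancels.
      c≈a = *-cancelˡ a≉0 $ *-cancelˡ a≉0 $ begin
        a * (a * c)            ≈⟨ *-congˡ (*-congˡ (trans (φx≈x²[x³]ʲ b) (*-congˡ (^-congˡ j b³≈a³)))) ⟩
        a * (a * (b * b * A))  ≈⟨ solve 3 (λ a b A → a :* (a :* (b :* b :* A)) := b :* b :* (a :* a :* A)) refl a b A ⟩
        b * b * (a * a * A)    ≈⟨ *-congˡ (φx≈x²[x³]ʲ a) ⟨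
        b * b * b              ≈⟨ solve 1 (λ b → b :* b :* b := b :* (b :* (b :* con 1))) refl b ⟩
        b ^ 3                  ≈⟨ b³≈a³ ⟩
        a ^ 3                  ≈⟨ *-congˡ (*-congˡ (*-identityʳ a)) ⟩
        a * (a * a)            ∎
      -- Applying `φ` to `c ≈ a` gives `φ c ≈ b`, while `φ c` is `φ³ a ≈ a`.
      b≈a : b ≈ a
      b≈a = trans (sym (φ-cong c≈a)) (φ³≈id a)

    f≈φ[Q*x]-Q*x : ∀ {x} → tr x ≈ 0# → f x ≈ φ (Q x * x) - Q x * x
    f≈φ[Q*x]-Q*x {x} trx≈0 = begin
      f x                    ≈⟨ f≈Q*[φx-x] x ⟩
      Q x * (φ x - x)        ≈⟨ x[y-z]≈xy-xz _ _ _ ⟩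
      Q x * φ x - Q x * x    ≈⟨ +-congʳ (trans (φ-homo-* (Q x) x) (*-congʳ (Q-fixed trx≈0))) ⟨
      φ (Q x * x) - Q x * x  ∎

    -- `φ - 1` is injective on the kernel of the trace: the difference of the two products is fixed
    -- by `φ` and has trace zero, hence is zero.
    Qx*x≈Qy*y : ∀ {x y} → tr x ≈ 0# → tr y ≈ 0# → f x ≈ f y → Q x * x ≈ Q y * y
    Qx*x≈Qy*y {x} {y} trx≈0 try≈0 fx≈fy = x-y≈0⇒x≈y (fixed∧Γ⇒≈0 φ-fixed tr-zero)
      where
      X = Q x * x
      Y = Q y * y
      φX-X≈φY-Y : φ X - X ≈ φ Y - Y
      φX-X≈φY-Y = trans (sym (f≈φ[Q*x]-Q*x trx≈0)) (trans fx≈fy (f≈φ[Q*x]-Q*x try≈0))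
      φ-fixed : φ (X - Y) ≈ X - Y
      φ-fixed = trans (φ-homo-sub X Y) (x-y≈z-w (begin
        φ X + Y                ≈⟨ x-y+y≈x (φ X) X Y ⟨
        φ X - X + (X + Y)      ≈⟨ +-congʳ φX-X≈φY-Y ⟩
        φ Y - Y + (X + Y)      ≈⟨ +-congˡ (+-comm X Y) ⟩
        φ Y - Y + (Y + X)      ≈⟨ x-y+y≈x (φ Y) Y X ⟩
        φ Y + X                ≈⟨ +-comm _ _ ⟩
        X + φ Y                ∎))
        where
        x-y+y≈x : ∀ x y z → x - y + (y + z) ≈ x + z
        x-y+y≈x x y z = trans (sym (+-assoc _ _ _)) (+-congʳ
          (trans (+-assoc _ _ _) (trans (+-congˡ (-‿inverseˡ y)) (+-identityʳ x))))
      tr-zero : tr (X - Y) ≈ 0#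
      tr-zero = trans (tr-homo-sub X Y) (x≈y⇒x-y≈0
        (trans (tr≈0-fixed-* (Q-fixed trx≈0) trx≈0) (sym (tr≈0-fixed-* (Q-fixed try≈0) try≈0))))

    Q[Q*x]≈Q³ : ∀ {x} → tr x ≈ 0# → Q (Q x * x) ≈ Q x ^ 3
    Q[Q*x]≈Q³ {x} trx≈0 = trans (Q-fixed-* x (Q-fixed trx≈0))
      (trans (*-assoc _ _ _) (*-congˡ (*-congˡ (sym (*-identityʳ (Q x))))))

    Qx≈Qy : ∀ {x y} → tr x ≈ 0# → tr y ≈ 0# → f x ≈ f y → Q x ≈ Q y
    Qx≈Qy trx≈0 try≈0 fx≈fy = cubing-injective-on-fixed (Q-fixed trx≈0) (Q-fixed try≈0)
      (trans (sym (Q[Q*x]≈Q³ trx≈0)) (trans (Q-cong (Qx*x≈Qy*y trx≈0 try≈0 fx≈fy)) (Q[Q*x]≈Q³ try≈0)))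

    f-injective : ∀ {x y} → tr x ≈ 0# → tr y ≈ 0# → f x ≈ f y → x ≈ y
    f-injective {x} {y} trx≈0 try≈0 fx≈fy with Q x ≟ 0#
    ... | yes Qx≈0 = trans (Q-anisotropic trx≈0 Qx≈0)
                           (sym (Q-anisotropic try≈0 (trans (sym (Qx≈Qy trx≈0 try≈0 fx≈fy)) Qx≈0)))
    ... | no Qx≉0 = *-cancelˡ Qx≉0 (trans (Qx*x≈Qy*y trx≈0 try≈0 fx≈fy) (*-congʳ (sym (Qx≈Qy trx≈0 try≈0 fx≈fy))))

    -- First `w` is written as `φ v - v` with `v` of trace zero. Then `f (s * v) = s³ Q(v) w` for
    -- every fixed `s`, and `s` is chosen so that the factor `s³ Q(v)` leaves `w` unchanged.
    f-surjective : ∀ {w} → tr w ≈ 0# → ∃[ x ] tr x ≈ 0# × f x ≈ w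
    f-surjective {w} trw≈0 with inverse 3≉0
    ... | i , 3i≈1 = x , tr≈0-fixed-* φs≈s trv≈0 , fx≈w
      where
      φi≈i : φ i ≈ i
      φi≈i = *-cancelˡ 3≉0 $ begin
        three * φ i    ≈⟨ *-comm _ _ ⟩
        φ i * three    ≈⟨ *-congˡ φ3≈3 ⟨
        φ i * φ three  ≈⟨ φ-homo-* i three ⟨
        φ (i * three)  ≈⟨ φ-cong 3i≈1 ⟩
        φ 1#           ≈⟨ φ-1 ⟩
        1#             ≈⟨ 3i≈1 ⟨
        i * three      ≈⟨ *-comm _ _ ⟩
        three * i      ∎
        where
        φ3≈3 : φ three ≈ three
        φ3≈3 = φ[1+x] (φ[1+x] (φ[1+x] φ-0))
          where
          φ[1+x] : ∀ {x} → φ x ≈ x → φ (1# + x) ≈ 1# + x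
          φ[1+x] φx≈x = trans (φ-homo-+ 1# _) (+-cong φ-1 φx≈x)
      -- (φ - 1)(φ² - 1) = φ³ - φ² - φ + 1 is multiplication by 3 on the kernel of φ² + φ + 1.
      v = i * (φ (φ w) - w)
      trv≈0 : tr v ≈ 0#
      trv≈0 = tr≈0-fixed-* φi≈i (trans (tr-homo-sub _ _) (x≈y⇒x-y≈0 (trans (tr-φ (φ w)) (tr-φ w))))
      φv-v≈w : φ v - v ≈ w
      φv-v≈w = begin
        φ v - v
          ≈⟨ +-congʳ (trans (φ-fixed-* _ φi≈i) (*-congˡ (trans (φ-homo-sub _ _) (+-congʳ (φ³≈id w))))) ⟩
        i * (w - φ w) - i * (φ (φ w) - w)        ≈⟨ x[y-z]≈xy-xz _ _ _ ⟨
        i * ((w - φ w) - (φ (φ w) - w))          ≈⟨ *-congˡ 3w ⟩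
        i * (three * w)                          ≈⟨ *-assoc _ _ _ ⟨
        i * three * w                            ≈⟨ *-congʳ 3i≈1 ⟩
        1# * w                                   ≈⟨ *-identityˡ w ⟩
        w                                        ∎
        where
        3w : (w - φ w) - (φ (φ w) - w) ≈ three * w
        3w = begin
          (w - φ w) - (φ (φ w) - w)
            ≈⟨ +-cong refl (⁻¹-anti-homo‿- (φ (φ w)) w) ⟩
          (w - φ w) + (w - φ (φ w))
            ≈⟨ +-identityʳ _ ⟨
          (w - φ w) + (w - φ (φ w)) + 0#
            ≈⟨ +-congˡ trw≈0 ⟨
          (w - φ w) + (w - φ (φ w)) + tr w
            ≈⟨ solve 5 (λ a b c b′ c′ → (a :+ b′) :+ (a :+ c′) :+ (c :+ b :+ a)
                  := (con 1 :+ (con 1 :+ (con 1 :+ con 0))) :* a :+ ((b :+ b′) :+ (c :+ c′)))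
                 refl w (φ w) (φ (φ w)) (- φ w) (- φ (φ w)) ⟩
          three * w + ((φ w - φ w) + (φ (φ w) - φ (φ w)))
            ≈⟨ +-congˡ (trans (+-cong (-‿inverseʳ _) (-‿inverseʳ _)) (+-identityˡ 0#)) ⟩
          three * w + 0#
            ≈⟨ +-identityʳ _ ⟩
          three * w ∎
      t = Q v
      -- As `q - 1 = 1 + 3j`, a nonzero fixed `t` satisfies `t * s ^ 3 = t ^ (q - 1) = 1`.
      s = t ^ j
      φt≈t : φ t ≈ t
      φt≈t = Q-fixed trv≈0
      φs≈s : φ s ≈ s
      φs≈s = trans (φ-homo-^ t j) (^-congˡ j φt≈t)
      x = s * v
      -- Keeping the factor `w` covers `t ≈ 0#` as well: then `v`, and so `w`, is zero.
      ts³w≈w : t * s ^ 3 * w ≈ w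
      ts³w≈w with t ≟ 0#
      ... | yes t≈0 = trans (*-congˡ w≈0) (trans (zeroʳ _) (sym w≈0))
        where
        v≈0 : v ≈ 0#
        v≈0 = Q-anisotropic trv≈0 t≈0
        w≈0 : w ≈ 0#
        w≈0 = trans (sym φv-v≈w) (x≈y⇒x-y≈0 (trans (φ-cong v≈0) (trans φ-0 (sym v≈0))))
      ... | no t≉0 = trans (*-congʳ ts³≈1) (*-identityˡ w)
        where
        ts³≈1 : t * s ^ 3 ≈ 1#
        ts³≈1 = *-cancelˡ t≉0 $ begin
          t * (t * s ^ 3)      ≈⟨ *-assoc _ _ _ ⟨
          t * t * s ^ 3
            ≈⟨ *-congˡ (trans (^-assocʳ t j 3) (trans (^-congʳ t (ℕ.*-comm j 3)) (sym (^-assocʳ t 3 j)))) ⟩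
          t * t * (t ^ 3) ^ j  ≈⟨ φx≈x²[x³]ʲ t ⟨
          φ t                  ≈⟨ φt≈t ⟩
          t                    ≈⟨ *-identityʳ t ⟨
          t * 1#               ∎
      fx≈w : f x ≈ w
      fx≈w = begin
        f x                          ≈⟨ f≈Q*[φx-x] x ⟩
        Q x * (φ x - x)              ≈⟨ *-cong (Q-fixed-* v φs≈s) (+-congʳ (φ-fixed-* v φs≈s)) ⟩
        s * s * t * (s * φ v - s * v) ≈⟨ *-congˡ (trans (sym (x[y-z]≈xy-xz _ _ _)) (*-congˡ φv-v≈w)) ⟩
        s * s * t * (s * w)
          ≈⟨ solve 3 (λ s t w → s :* s :* t :* (s :* w) := t :* (s :* (s :* (s :* con 1))) :* w) refl s t w ⟩
        t * s ^ 3 * w                ≈⟨ ts³w≈w ⟩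
        w                            ∎

    f-permutes : Permutes f (Γ q)
    f-permutes = (λ {x} _ → Γ-f x)
      , (λ {x} {y} → f-injective (Γ⇒tr≈0 (proj₂ x)) (Γ⇒tr≈0 (proj₂ y)))
      , λ (w , w∈Γ) → let x , trx≈0 , fx≈w = f-surjective (Γ⇒tr≈0 w∈Γ) in
          (x , tr≈0⇒Γ trx≈0) , λ z≈x → trans (f-cong z≈x) fx≈w

  -- Failure of injectivity when `q` is 0 or 1 modulo 3.

  -- The trace of `1#` is 3, so `3 = 0` would put `1#` in `Γ`; but `f` vanishes at every fixed
  -- element, in particular at both `0#` and `1#`.
  permutes⇒three≉0 : Permutes f (Γ q) → three ≉ 0#
  permutes⇒three≉0 (_ , injective , _) 3≈0 = 1≉0 (injective {1# , 1∈Γ} {0# , 0∈Γ} (trans f1≈0 (sym f0≈0)))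
    where
    fixed⇒f≈0 : ∀ {x} → φ x ≈ x → f x ≈ 0#
    fixed⇒f≈0 φx≈x = x≈y⇒x-y≈0 (trans (φ-homo-^ _ 3) (^-congˡ 3 φx≈x))
    f1≈0 : f 1# ≈ 0#
    f1≈0 = fixed⇒f≈0 φ-1
    f0≈0 : f 0# ≈ 0#
    f0≈0 = fixed⇒f≈0 φ-0
    0∈Γ : Γ q 0#
    0∈Γ = tr≈0⇒Γ (trans (+-congʳ (+-cong (trans (φ-cong φ-0) φ-0) φ-0)) (trans (+-identityʳ _) (+-identityʳ _)))
    1∈Γ : Γ q 1#
    1∈Γ = tr≈0⇒Γ (trans (+-congʳ (+-cong (trans (φ-cong φ-1) φ-1) φ-1))
      (trans (solve 0 ((con 1 :+ con 1) :+ con 1 := con 1 :+ (con 1 :+ (con 1 :+ con 0))) refl) 3≈0))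

  3∣q⇒three≈0 : 3 ∣ q → three ≈ 0#
  3∣q⇒three≈0 d = trans (×-congˡ (≡.sym (3∣p^k⇒p≡3 (suc k) p-prime d))) p×1≈0

  q≡1⇒¬permutes : ∀ j → q ≡ 1 ℕ.+ 3 ℕ.* j → ¬ Permutes f (Γ q)
  q≡1⇒¬permutes zero    q≡1    _ = ℕ.<-irrefl (≡.sym q≡1) 1<q
  q≡1⇒¬permutes j@(suc j-1) q≡1+3j (_ , injective , _) =
    x≉0 (x*z≈y*z⇒z≈0 ω≉1 (trans ωx≈x (sym (*-identityˡ x))))
    where
    m : ℕ
    m = 3 ℕ.* j ℕ.+ 9 ℕ.* (j ℕ.* j) ℕ.+ 9 ℕ.* (j ℕ.* (j ℕ.* j))
    q³≡1+3m : q ℕ.^ 3 ≡ 1 ℕ.+ m ℕ.* 3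
    q³≡1+3m = ≡.trans (≡.cong (ℕ._^ 3) q≡1+3j) ([1+3j]³≡1+3m j)
    -- `m` is positive because `j` is, so `m + 1 < 3m + 1`.
    1+m<q³ : suc m < q ℕ.^ 3
    1+m<q³ = ≡.subst (suc m <_) (≡.sym q³≡1+3m) (s<s (ℕ.m<m*n m 3 (s<s z<s)))

    -- An element with `y ^ (m + 1)` different from `y` is nonzero and has `y ^ m` different from 1;
    -- since `3m = q³ - 1`, that power is a nontrivial cube root of unity.
    y-pair = ∃x^d≉x {suc m} (s<s z<s) 1+m<q³
    y = proj₁ y-pair
    ω = y ^ m
    ω≉1 : ω ≉ 1#
    ω≉1 ω≈1 = proj₂ y-pair (trans (*-congˡ ω≈1) (*-identityʳ y))
    y≉0 : y ≉ 0#
    y≉0 y≈0 = proj₂ y-pair (trans (*-congʳ y≈0) (trans (zeroˡ _) (sym y≈0)))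
    ω³≈1 : ω ^ 3 ≈ 1#
    ω³≈1 = *-cancelˡ y≉0 $ begin
      y * (y ^ m) ^ 3       ≈⟨ *-congˡ (^-assocʳ y m 3) ⟩
      y ^ (1 ℕ.+ m ℕ.* 3)   ≈⟨ ^-congʳ y q³≡1+3m ⟨
      y ^ (q ℕ.^ 3)         ≈⟨ x^order≈x y ⟩
      y                     ≈⟨ *-identityʳ y ⟨
      y * 1#                ∎
    -- `ω` lies in the fixed field because 3 divides `q - 1`.
    φω≈ω : φ ω ≈ ω
    φω≈ω = begin
      ω ^ q                   ≈⟨ ^-congʳ ω q≡1+3j ⟩
      ω * ω ^ (3 ℕ.* j)       ≈⟨ *-congˡ (^-assocʳ ω 3 j) ⟨
      ω * (ω ^ 3) ^ j         ≈⟨ *-congˡ (trans (^-congˡ j ω³≈1) (1^n≈1 j)) ⟩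
      ω * 1#                  ≈⟨ *-identityʳ ω ⟩
      ω                       ∎

    -- `X^q - X` cannot vanish on all `q³` elements, so some `z` is not fixed, and `φ z - z` is a
    -- nonzero element of `Γ`.
    z-pair = ∃x^d≉x 1<q q<q³
    z = proj₁ z-pair
    x = φ z - z
    x≉0 : x ≉ 0#
    x≉0 = proj₂ z-pair ∘ x-y≈0⇒x≈y
    trx≈0 : tr x ≈ 0#
    trx≈0 = tr[φx-x]≈0 z

    [ωx]³≈x³ : (ω * x) ^ 3 ≈ x ^ 3
    [ωx]³≈x³ = trans (^-distrib-* ω x 3) (trans (*-congʳ ω³≈1) (*-identityˡ _))
    fωx≈fx : f (ω * x) ≈ f x
    fωx≈fx = +-cong (φ-cong [ωx]³≈x³) (-‿cong [ωx]³≈x³)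
    ωx≈x : ω * x ≈ x
    ωx≈x = injective {ω * x , tr≈0⇒Γ (tr≈0-fixed-* φω≈ω trx≈0)} {x , tr≈0⇒Γ trx≈0} fωx≈fx

  q≡q%3+3[q/3] : q ≡ q % 3 ℕ.+ 3 ℕ.* (q ℕ./ 3)
  q≡q%3+3[q/3] = ≡.trans (m≡m%n+[m/n]*n q 3) (≡.cong (q % 3 ℕ.+_) (ℕ.*-comm (q ℕ./ 3) 3))

  permutes⇒q%3≡2 : Permutes f (Γ q) → q % 3 ≡ 2
  permutes⇒q%3≡2 perm with q % 3 in eq | m%n<n q 3 | q≡q%3+3[q/3]
  ... | 0 | _ | _ = contradiction (3∣q⇒three≈0 (m%n≡0⇒n∣m q 3 eq)) (permutes⇒three≉0 perm)
  ... | 1 | _ | q≡ = contradiction perm (q≡1⇒¬permutes (q ℕ./ 3) q≡)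
  ... | 2 | _ | _ = ≡.refl
  ... | suc (suc (suc _)) | s≤s (s≤s (s≤s ())) | _

  q%3≡2⇒permutes : q % 3 ≡ 2 → Permutes f (Γ q)
  q%3≡2⇒permutes eq =
    q≡2.f-permutes (q ℕ./ 3) (≡.trans q≡q%3+3[q/3] (≡.cong (ℕ._+ 3 ℕ.* (q ℕ./ 3)) eq))

  f≈x³ᑫ-x³ : ∀ x → f x ≈ x ^ (3 ℕ.* q) - x ^ 3
  f≈x³ᑫ-x³ x = +-congʳ (^-assocʳ x 3 q)

theorem1p7 : ∀ {c ℓ₁ ℓ₂} (q : ℕ) → IsPrimePower q →
    (F : HeytingField c ℓ₁ ℓ₂) → let open FieldDefs F in
    HasOrder (q ℕ.^ 3) →
    (∀ x → [X^ q -X]∘X^3 x ≈ x ^ (3 ℕ.* q) - x ^ 3) ×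
    (Permutes [X^ q -X]∘X^3 (Γ q) ⇔ q % 3 ≡ 2)
theorem1p7 _ (p , k , p-prime , ≡.refl) F order =
  f≈x³ᑫ-x³ , mk⇔ permutes⇒q%3≡2 q%3≡2⇒permutes
  where open Trace F p k p-prime order
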